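{- Let $d$ and $\Delta$ be integers with $2\le d\le\Delta$, and let $G$ be a finite simple $d$-degenerate graph with maximum degree $\Delta(G)\le\Delta$. If $q_B(G)=d\Delta-1$, then there are sets $X,Y\subseteq V(G)$ and a vertex $u^*\notin X$ such that $|X|=d-1$, $|Y|=\Delta$, $N_G(x)=Y$ for every $x\in X$, and $$|Y\setminus N_G(u^*)|=1,\qquad |N_G(u^*)\setminus Y|\le1.$$ Thus $X$ is a set of pairwise false twins, each of degree $\Delta$. In particular, $G$ contains a copy of $K_{d,\Delta-1}$.
   Context: A $B$-coloring of a graph $G$ is a proper edge-coloring (incident edges receive distinct colors) in which the edges of every $4$-cycle receive four distinct colors; $q_B(G)$ is the minimum number of colors in a $B$-coloring of $G$. A graph is $d$-degenerate if every nonempty subgraph has a vertex of degree at most $d$ (in that subgraph). "Contains a copy of $K_{a,b}$" means contains a subgraph, not necessarily induced, isomorphic to the complete bipartite graph $K_{a,b}$. $N_G(x)$ is the open neighborhood of $x$ and $\Delta(G)$ the maximum degree of $G$. Two distinct vertices are false twins if they have the same open neighborhood. -}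

module Defs where

open import Data.Bool.Base using (false; _xor_)
open import Data.Bool.Properties using (xor-comm; xor-same)
open import Data.Fin.Base using (Fin; toℕ)
open import Data.Fin.Subset using (Subset; inside; _∈_; ∣_∣; Nonempty)
open import Data.List.Base using (_∷_; [])
open import Data.List.Relation.Unary.Unique.Propositional using (Unique)
open import Data.Nat.Base using (ℕ; _+_; _⊔_; _≤_)
open import Data.Nat.Properties using (_<?_)
open import Data.Product.Base using (∃; ∃-syntax; _×_)
open import Data.Vec.Base using (tabulate)
open import Data.Vec.Functional using (foldr)
open import Data.Vec.Properties using (lookup∘tabulate; []=⇒lookup; lookup⇒[]=)
open import Function.Bundles using (_⇔_)
open import Function.Definitions using (Injective)
open import Relation.Binary.PropositionalEquality using (_≡_; _≢_; sym; trans)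
open import Relation.Nullary.Decidable using (does)
open import Relation.Nullary.Negation using (¬_)

private
  variable
    m n : ℕ

-- A finite simple graph with vertex set Fin n, given by its open
-- neighbourhoods (the rows of its adjacency matrix).
record Graph (n : ℕ) : Set where
  field
    N        : Fin n → Subset n
    N-sym    : ∀ {u v} → v ∈ N u → u ∈ N v
    N-irrefl : ∀ {u} → ¬ (u ∈ N u)

  infix 4 _~_
  _~_ : Fin n → Fin n → Set
  u ~ v = v ∈ N u

  degree : Fin n → ℕ
  degree v = ∣ N v ∣

  maxDegree : ℕ
  maxDegree = foldr _⊔_ 0 degree

open Graph public using (N; degree; maxDegree)

-- Not necessarily induced. The edge set is carried by a graph on the ambient
-- vertices all of whose edges have their endpoints in `vertices`, so degrees
-- in `edges` are degrees in the subgraph.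
record Subgraph (G : Graph n) : Set where
  field
    vertices  : Subset n
    edges     : Graph n
    edges⊆    : ∀ {u v} → Graph._~_ edges u v → Graph._~_ G u v
    endpoints : ∀ {u v} → Graph._~_ edges u v → u ∈ vertices

Degenerate : ℕ → Graph n → Set
Degenerate d G = (H : Subgraph G) → let open Subgraph H in
  Nonempty vertices → ∃[ v ] (v ∈ vertices × degree edges v ≤ d)

-- Colours are assigned to ordered pairs of adjacent vertices; `undirected`
-- (which quantifies over all adjacency proofs) makes this a colouring of the
-- edges.
record BColouring (G : Graph n) (k : ℕ) : Set where
  open Graph G using (_~_)
  field
    colour     : ∀ u v → u ~ v → Fin k
    undirected : ∀ {u v} (e : u ~ v) (e′ : v ~ u) → colour u v e ≡ colour v u e′
    proper     : ∀ {u v w} (e : u ~ v) (f : u ~ w) → v ≢ w →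
                 colour u v e ≢ colour u w f
    rainbow-C₄ : ∀ {w x y z} → Unique (w ∷ x ∷ y ∷ z ∷ []) →
                 (e₁ : w ~ x) (e₂ : x ~ y) (e₃ : y ~ z) (e₄ : z ~ w) →
                 Unique (colour w x e₁ ∷ colour x y e₂ ∷
                         colour y z e₃ ∷ colour z w e₄ ∷ [])

-- The graph of the function q_B: `qB G ≔ k` says that k is the least number
-- of colours in a B-colouring of G.
qB_≔_ : Graph n → ℕ → Set
qB G ≔ k = BColouring G k × (∀ j → BColouring G j → k ≤ j)

FalseTwins : Graph n → Fin n → Fin n → Set
FalseTwins G x y = x ≢ y × N G x ≡ N G y

-- K_{a,b} on Fin (a + b): the parts are the first a and the last b vertices.
completeBipartite : ∀ a b → Graph (a + b)
completeBipartite a b = record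
  { N        = row
  ; N-sym    = λ {u} {v} p → lookup⇒[]= u (row v)
                 (trans (lookup∘tabulate _ u)
                 (trans (xor-comm (left v) (left u)) (entry u v p)))
  ; N-irrefl = λ {u} p → irrefl (trans (sym (xor-same (left u))) (entry u u p))
  }
  where
  left = λ (i : Fin (a + b)) → does (toℕ i <? a)

  row : Fin (a + b) → Subset (a + b)
  row i = tabulate λ j → left i xor left j

  entry : ∀ u v → v ∈ row u → left u xor left v ≡ inside
  entry u v p = trans (sym (lookup∘tabulate _ v)) ([]=⇒lookup p)

  irrefl : ¬ (false ≡ inside)
  irrefl ()

record IsoToSubgraph (K : Graph m) {G : Graph n} (H : Subgraph G) : Set where
  open Subgraph H
  field
    to        : Fin m → Fin n
    injective : Injective _≡_ _≡_ to
    image     : ∀ v → v ∈ vertices ⇔ ∃ (λ i → to i ≡ v)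
    adjacency : ∀ i j → Graph._~_ K i j ⇔ Graph._~_ edges (to i) (to j)

ContainsCopy : Graph n → Graph m → Set
ContainsCopy G K = ∃ λ (H : Subgraph G) → IsoToSubgraph K H

-- Colour greedily with dΔ − 2 colours, adding one vertex v with at most d earlier
-- neighbours T at a time. If R u is the set of earlier neighbours of u ∈ T, then the
-- edge v u must avoid at most Σ_{w ∈ T} |R u ∩ R w| ≤ |T|(Δ − 1) colours, besides those of
-- the other edges at v. The greedy step succeeds when |T| < d, and when |T| = d if no sum
-- attains d(Δ − 1) and some sum is at most d(Δ − 1) − 2 (the edge to that u is coloured
-- last). If a sum attains d(Δ − 1), all R w with w ∈ T coincide and v completes a
-- K_{d,Δ}, which needs dΔ colours. Otherwise every sum is d(Δ − 1) − 1, so each R u has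
-- Δ − 1 elements and differs from R w for exactly one w ∈ T. Since equality is
-- transitive, this forces d = 2, and the two neighbours of v are X = {u} and u* = w; for
-- d ≥ 3 the value dΔ − 1 is never attained.

module Submission where

open import Defs
open import Algebra.Properties.CommutativeSemigroup using (x∙yz≈y∙xz)
open import Data.Bool.Base using (_xor_)
open import Data.Empty using (⊥-elim)
open import Data.Fin.Base using (Fin; zero; suc; toℕ; fromℕ<; combine; remQuot)
open import Data.Fin.Properties
  using (_≟_; pigeonhole; any?; suc-injective; <⇒≢; injective⇒≤; combine-remQuot)
open import Data.Fin.Subset
  using (Subset; inside; outside; _∈_; _∉_; _⊆_; _⊂_; _─_; _-_; _∩_; _∪_; ⁅_⁆; ⊤; ∣_∣; Nonempty)
open import Data.Fin.Subset.Induction using (⊂-wellFounded)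
open import Data.Fin.Subset.Properties
open import Data.List.Base using (List; []; _∷_; _++_; length; map; concatMap; lookup; tabulate)
open import Data.List.Membership.DecPropositional using () renaming (_∈?_ to member?)
open import Data.List.Membership.Propositional using (lose) renaming (_∈_ to _∈ᴸ_; _∉_ to _∉ᴸ_)
open import Data.List.Membership.Propositional.Properties
  using (∈-map⁺; ∈-++⁺ˡ; ∈-++⁺ʳ; ∈-concatMap⁺; ∈-tabulate⁺; ∈-tabulate⁻)
open import Data.List.Properties using (length-map; length-++; length-tabulate)
open import Data.List.Relation.Unary.All using ([]; _∷_)
open import Data.List.Relation.Unary.AllPairs using ([]; _∷_)
open import Data.List.Relation.Unary.Any using (here; there; index)
open import Data.List.Relation.Unary.Any.Properties using (lookup-index)
open import Data.List.Relation.Unary.Unique.Propositional using (Unique)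
open import Data.Nat.Base
  using (ℕ; zero; suc; pred; _+_; _*_; _∸_; _⊔_; _≤_; _<_; z≤n; s≤s)
open import Data.Nat.Properties
  using (≤-refl; ≤-trans; ≤-reflexive; ≤-antisym; ≤-pred; <-irrefl; <-≤-trans; ≤-<-trans;
         <⇒≤; <⇒≱; ≰⇒>; ≮⇒≥; ≤∧≢⇒<; _≤?_; _<?_; n≤1+n; m≤m⊔n; m≤n⊔m;
         +-comm; +-assoc; +-suc; +-commutativeSemigroup; +-cancelˡ-≡; +-mono-≤; +-monoˡ-≤;
         +-monoʳ-≤; +-monoʳ-<; *-suc; *-mono-≤; *-monoˡ-≤; m+[n∸m]≡n; ∸-monoˡ-≤; ∸-monoʳ-<;
         module ≤-Reasoning)
  renaming (_≟_ to _≟ℕ_)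
open import Data.Product.Base using (∃-syntax; _×_; _,_; proj₁; proj₂; uncurry)
open import Data.Sum.Base using (_⊎_; inj₁; inj₂; map₁; [_,_]′)
import Data.Vec.Base as Vec
open import Data.Vec.Base using ([]; _∷_; here; there)
import Data.Vec.Functional as Functional
open import Data.Vec.Properties using (lookup∘tabulate; []=⇒lookup; lookup⇒[]=)
open import Function.Base using (_∘_; const; id)
open import Function.Bundles using (mk⇔)
open import Function.Definitions using (Injective)
open import Induction.WellFounded using (Acc; acc)
open import Relation.Binary.PropositionalEquality
  using (_≡_; _≢_; refl; sym; trans; cong; cong₂; subst)
open import Relation.Nullary.Decidable
  using (Dec; yes; no; does; dec-true; decidable-stable; _×-dec_; ¬?)
open import Relation.Nullary.Negation using (¬_; contradiction)

private
  variable
    n K : ℕ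
    A B : Set

-- Finite subsets: cardinalities and enumeration.

x∈p─q⇒x∉q : ∀ {x : Fin n} (p q : Subset n) → x ∈ p ─ q → x ∉ q
x∈p─q⇒x∉q (_ ∷ p) (outside ∷ q) (there i) (there j) = x∈p─q⇒x∉q p q i j
x∈p─q⇒x∉q (_ ∷ p) (inside  ∷ q) (there i) (there j) = x∈p─q⇒x∉q p q i j

x∈p-y⇒x≢y : ∀ {x y : Fin n} (p : Subset n) → x ∈ p - y → x ≢ y
x∈p-y⇒x≢y {y = y} p x∈ refl = x∈p─q⇒x∉q p ⁅ y ⁆ x∈ (x∈⁅x⁆ y)

∣q∣<∣p∣⇒∃x∈p∖q : ∀ (p q : Subset n) → ∣ q ∣ < ∣ p ∣ → ∃[ x ] (x ∈ p × x ∉ q)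
∣q∣<∣p∣⇒∃x∈p∖q p q lt with any? (λ x → (x ∈? p) ×-dec ¬? (x ∈? q))
... | yes found = found
... | no  none  = contradiction (≤-trans lt (p⊆q⇒∣p∣≤∣q∣ p⊆q)) (<-irrefl refl)
  where
  p⊆q : p ⊆ q
  p⊆q {x} x∈p = decidable-stable (x ∈? q) (λ x∉q → none (x , x∈p , x∉q))

p⊆q∧∣q∣≤∣p∣⇒q⊆p : ∀ {p q : Subset n} → p ⊆ q → ∣ q ∣ ≤ ∣ p ∣ → q ⊆ p
p⊆q∧∣q∣≤∣p∣⇒q⊆p {p = p} p⊆q le {x} x∈q = decidable-stable (x ∈? p)
  λ x∉p → <-irrefl refl (<-≤-trans (p⊂q⇒∣p∣<∣q∣ (p⊆q , x , x∈q , x∉p)) le)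

∣p∣≡∣p∩q∣+∣p─q∣ : ∀ (p q : Subset n) → ∣ p ∣ ≡ ∣ p ∩ q ∣ + ∣ p ─ q ∣
∣p∣≡∣p∩q∣+∣p─q∣ []            []            = refl
∣p∣≡∣p∩q∣+∣p─q∣ (outside ∷ p) (inside  ∷ q) = ∣p∣≡∣p∩q∣+∣p─q∣ p q
∣p∣≡∣p∩q∣+∣p─q∣ (outside ∷ p) (outside ∷ q) = ∣p∣≡∣p∩q∣+∣p─q∣ p q
∣p∣≡∣p∩q∣+∣p─q∣ (inside  ∷ p) (inside  ∷ q) = cong suc (∣p∣≡∣p∩q∣+∣p─q∣ p q)
∣p∣≡∣p∩q∣+∣p─q∣ (inside  ∷ p) (outside ∷ q) =
  trans (cong suc (∣p∣≡∣p∩q∣+∣p─q∣ p q)) (sym (+-suc _ _))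

∣p∪q∣≤∣p∣+∣q∣ : ∀ (p q : Subset n) → ∣ p ∪ q ∣ ≤ ∣ p ∣ + ∣ q ∣
∣p∪q∣≤∣p∣+∣q∣ []            []            = z≤n
∣p∪q∣≤∣p∣+∣q∣ (outside ∷ p) (outside ∷ q) = ∣p∪q∣≤∣p∣+∣q∣ p q
∣p∪q∣≤∣p∣+∣q∣ (outside ∷ p) (inside  ∷ q) =
  ≤-trans (s≤s (∣p∪q∣≤∣p∣+∣q∣ p q)) (≤-reflexive (sym (+-suc _ _)))
∣p∪q∣≤∣p∣+∣q∣ (inside  ∷ p) (outside ∷ q) = s≤s (∣p∪q∣≤∣p∣+∣q∣ p q)
∣p∪q∣≤∣p∣+∣q∣ (inside  ∷ p) (inside  ∷ q) =
  s≤s (≤-trans (∣p∪q∣≤∣p∣+∣q∣ p q) (+-monoʳ-≤ ∣ p ∣ (n≤1+n _)))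

-- The increasing enumeration of `p`. It produces the lists from which colours are collected, and it
-- also indexes the vertices of complete bipartite graphs.
nth : (p : Subset n) → Fin ∣ p ∣ → Fin n
nth (outside ∷ p) i       = suc (nth p i)
nth (inside  ∷ p) zero    = zero
nth (inside  ∷ p) (suc i) = suc (nth p i)

nth-∈ : ∀ (p : Subset n) i → nth p i ∈ p
nth-∈ (outside ∷ p) i       = there (nth-∈ p i)
nth-∈ (inside  ∷ p) zero    = here
nth-∈ (inside  ∷ p) (suc i) = there (nth-∈ p i)

nth-injective : ∀ (p : Subset n) {i j} → nth p i ≡ nth p j → i ≡ j
nth-injective (outside ∷ p)                 eq = nth-injective p (suc-injective eq)
nth-injective (inside  ∷ p) {zero}  {zero}  eq = refl
nth-injective (inside  ∷ p) {suc i} {suc j} eq = cong suc (nth-injective p (suc-injective eq))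

nth-surjective : ∀ {p : Subset n} {x} → x ∈ p → ∃[ i ] nth p i ≡ x
nth-surjective {p = inside  ∷ p} here       = zero , refl
nth-surjective {p = inside  ∷ p} (there x∈) with i , refl ← nth-surjective x∈ = suc i , refl
nth-surjective {p = outside ∷ p} (there x∈) with i , refl ← nth-surjective x∈ = i , refl

elements : Subset n → List (Fin n)
elements p = tabulate (nth p)

length-elements : ∀ (p : Subset n) → length (elements p) ≡ ∣ p ∣
length-elements p = length-tabulate (nth p)

∈-elements⁺ : ∀ {p : Subset n} {x} → x ∈ p → x ∈ᴸ elements p
∈-elements⁺ {p = p} x∈ with i , refl ← nth-surjective x∈ = ∈-tabulate⁺ {f = nth p} i

∈-elements⁻ : ∀ {p : Subset n} {x} → x ∈ᴸ elements p → x ∈ p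
∈-elements⁻ {p = p} x∈ with i , refl ← ∈-tabulate⁻ {f = nth p} x∈ = nth-∈ p i

-- Free colours and lengths of concatenated lists.

fresh : (xs : List (Fin K)) → length xs < K → ∃[ c ] c ∉ᴸ xs
fresh {K} xs short with any? (λ c → ¬? (member? _≟_ c xs))
... | yes found = found
-- If every colour occurred in `xs`, sending a colour to a position where it occurs would inject
-- `Fin K` into a smaller set.
... | no  none  = contradiction i≡j (<⇒≢ i<j)
  where
  covered : ∀ c → c ∈ᴸ xs
  covered c = decidable-stable (member? _≟_ c xs) (λ c∉ → none (c , c∉))

  position : Fin K → Fin (length xs)
  position c = index (covered c)

  collision = pigeonhole short position
  i   = proj₁ collision
  j   = proj₁ (proj₂ collision)
  i<j = proj₁ (proj₂ (proj₂ collision))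

  i≡j : i ≡ j
  i≡j = trans (lookup-index (covered i))
       (trans (cong (lookup xs) (proj₂ (proj₂ (proj₂ collision))))
              (sym (lookup-index (covered j))))

length-concatMap-≥ : ∀ (g : A → List B) {m} xs → (∀ {x} → x ∈ᴸ xs → m ≤ length (g x)) →
                     length xs * m ≤ length (concatMap g xs)
length-concatMap-≥ g     []       m≤g = z≤n
length-concatMap-≥ g {m} (x ∷ xs) m≤g = begin
  m + length xs * m                      ≤⟨ +-mono-≤ (m≤g (here refl)) (length-concatMap-≥ g xs (m≤g ∘ there)) ⟩
  length (g x) + length (concatMap g xs) ≡⟨ length-++ (g x) ⟨
  length (g x ++ concatMap g xs)         ∎
  where open ≤-Reasoning

module _ (g : A → List B) {m : ℕ} (g≤m : ∀ x → length (g x) ≤ m) where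

  length-concatMap-≤ : ∀ xs → length (concatMap g xs) ≤ length xs * m
  length-concatMap-≤ []       = z≤n
  length-concatMap-≤ (x ∷ xs) = begin
    length (g x ++ concatMap g xs)         ≡⟨ length-++ (g x) ⟩
    length (g x) + length (concatMap g xs) ≤⟨ +-mono-≤ (g≤m x) (length-concatMap-≤ xs) ⟩
    m + length xs * m                      ∎
    where open ≤-Reasoning

  -- No list is longer than `m`, so a shortfall `a` in a single list survives in the total.
  length-concatMap-deficit : ∀ {xs x a} → x ∈ᴸ xs → a + length (g x) ≤ m →
                             a + length (concatMap g xs) ≤ length xs * m
  length-concatMap-deficit {y ∷ xs} {a = a} (here refl) le = begin
    a + length (g y ++ concatMap g xs)           ≡⟨ cong (a +_) (length-++ (g y)) ⟩
    a + (length (g y) + length (concatMap g xs)) ≡⟨ +-assoc a _ _ ⟨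
    a + length (g y) + length (concatMap g xs)   ≤⟨ +-mono-≤ le (length-concatMap-≤ xs) ⟩
    m + length xs * m                            ∎
    where open ≤-Reasoning
  length-concatMap-deficit {y ∷ xs} {a = a} (there x∈) le = begin
    a + length (g y ++ concatMap g xs)           ≡⟨ cong (a +_) (length-++ (g y)) ⟩
    a + (length (g y) + length (concatMap g xs)) ≡⟨ x∙yz≈y∙xz +-commutativeSemigroup a (length (g y)) _ ⟩
    length (g y) + (a + length (concatMap g xs)) ≤⟨ +-mono-≤ (g≤m y) (length-concatMap-deficit x∈ le) ⟩
    m + length xs * m                            ∎
    where open ≤-Reasoning

  -- Distinct elements sit at distinct positions of `xs`, so their two shortfalls of at least one
  -- add up.
  length-concatMap-deficit₂ : ∀ {xs x y} → x ∈ᴸ xs → y ∈ᴸ xs → x ≢ y →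
    length (g x) < m → length (g y) < m → 2 + length (concatMap g xs) ≤ length xs * m
  length-concatMap-deficit₂ (here refl) (here refl) x≢y _ _ = contradiction refl x≢y
  length-concatMap-deficit₂ {z ∷ xs} (here refl) (there y∈) _ gx gy = begin
    2 + length (g z ++ concatMap g xs)                   ≡⟨ cong (2 +_) (length-++ (g z)) ⟩
    2 + (length (g z) + length (concatMap g xs))         ≡⟨ cong suc (+-suc _ _) ⟨
    suc (length (g z)) + suc (length (concatMap g xs))   ≤⟨ +-mono-≤ gx (length-concatMap-deficit y∈ gy) ⟩
    m + length xs * m                                    ∎
    where open ≤-Reasoning
  length-concatMap-deficit₂ (there x∈) (here refl) x≢y gx gy =
    length-concatMap-deficit₂ (here refl) (there x∈) (x≢y ∘ sym) gy gx
  length-concatMap-deficit₂ {z ∷ xs} (there x∈) (there y∈) x≢y gx gy = begin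
    2 + length (g z ++ concatMap g xs)           ≡⟨ cong (2 +_) (length-++ (g z)) ⟩
    2 + (length (g z) + length (concatMap g xs)) ≡⟨ cong suc (+-suc _ _) ⟨
    suc (length (g z) + suc (length (concatMap g xs))) ≡⟨ +-suc _ _ ⟨
    length (g z) + (2 + length (concatMap g xs)) ≤⟨ +-mono-≤ (g≤m z) (length-concatMap-deficit₂ x∈ y∈ x≢y gx gy) ⟩
    m + length xs * m                            ∎
    where open ≤-Reasoning

-- Greedy choice of distinct colours.

record Choice {n K} (F : Fin n → List (Fin K)) (T : Subset n) : Set where
  field
    pick      : Fin n → Fin K
    distinct  : ∀ {x y} → x ∈ T → y ∈ T → x ≢ y → pick x ≢ pick y
    permitted : ∀ {x} → x ∈ T → pick x ∉ᴸ F x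

module _ (F : Fin n → List (Fin K)) where
  open Choice

  -- The colour of `u` has to avoid `F u` and the colours already given to `T - u`; the strict
  -- inequality leaves one colour free.
  choose-last : ∀ {T u} → Choice F (T - u) → length (F u) + ∣ T - u ∣ < K → Choice F T
  choose-last {T} {u} C short = record
    { pick = pick′ ; distinct = distinct′ ; permitted = permitted′ }
    where
    taken : List (Fin K)
    taken = map (pick C) (elements (T - u))

    length-avoid : length (F u ++ taken) < K
    length-avoid = subst (_< K) (sym (trans (length-++ (F u)) (cong (length (F u) +_)
      (trans (length-map (pick C) (elements (T - u))) (length-elements (T - u)))))) short

    new : ∃[ c ] c ∉ᴸ F u ++ taken
    new = fresh (F u ++ taken) length-avoid

    new∉taken : ∀ {x} → x ∈ T → x ≢ u → proj₁ new ≢ pick C x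
    new∉taken x∈ x≢u eq = proj₂ new (∈-++⁺ʳ (F u) (subst (_∈ᴸ taken) (sym eq)
      (∈-map⁺ (pick C) (∈-elements⁺ (x∈p∧x≢y⇒x∈p-y x∈ x≢u)))))

    pick′ : Fin n → Fin K
    pick′ x with x ≟ u
    ... | yes _ = proj₁ new
    ... | no  _ = pick C x

    distinct′ : ∀ {x y} → x ∈ T → y ∈ T → x ≢ y → pick′ x ≢ pick′ y
    distinct′ {x} {y} x∈ y∈ x≢y with x ≟ u | y ≟ u
    ... | yes refl | yes refl = contradiction refl x≢y
    ... | yes refl | no  y≢u  = new∉taken y∈ y≢u
    ... | no  x≢u  | yes refl = new∉taken x∈ x≢u ∘ sym
    ... | no  x≢u  | no  y≢u  =
      distinct C (x∈p∧x≢y⇒x∈p-y x∈ x≢u) (x∈p∧x≢y⇒x∈p-y y∈ y≢u) x≢y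

    permitted′ : ∀ {x} → x ∈ T → pick′ x ∉ᴸ F x
    permitted′ {x} x∈ with x ≟ u
    ... | yes refl = proj₂ new ∘ ∈-++⁺ˡ
    ... | no  x≢u  = permitted C (x∈p∧x≢y⇒x∈p-y x∈ x≢u)

  -- The bound is non-strict because, when an element of `T` receives its colour, at most `∣ T ∣` -
  -- 1 others have one. The colour `c₀` is the default value on the empty set.
  choose : Fin K → ∀ T → (∀ {x} → x ∈ T → length (F x) + ∣ T ∣ ≤ K) → Choice F T
  choose c₀ T = go T (⊂-wellFounded T)
    where
    go : ∀ T → Acc _⊂_ T → (∀ {x} → x ∈ T → length (F x) + ∣ T ∣ ≤ K) → Choice F T
    go T (acc rec) short with nonempty? T
    ... | no  empty    = record
      { pick      = const c₀
      ; distinct  = λ x∈ → ⊥-elim (empty (_ , x∈))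
      ; permitted = λ x∈ → ⊥-elim (empty (_ , x∈))
      }
    ... | yes (u , u∈) = choose-last
      (go (T - u) (rec (x∈p⇒p-x⊂p u∈)) λ {x} x∈ →
        ≤-trans (+-monoʳ-≤ (length (F x)) (<⇒≤ smaller)) (short (p─q⊆p T ⁅ u ⁆ x∈)))
      (<-≤-trans (+-monoʳ-< (length (F u)) smaller) (short u∈))
      where
      smaller : ∣ T - u ∣ < ∣ T ∣
      smaller = x∈p⇒∣p-x∣<∣p∣ u∈

-- Partial colourings and the two obstructions.

record PartialColouring (G : Graph n) (S : Subset n) (K : ℕ) : Set where
  open Graph G using (_~_)
  field
    -- Total and independent of adjacency proofs; apart from symmetry, only the values on edges of
    -- `G` inside `S` are constrained.
    col       : Fin n → Fin n → Fin K
    symmetric : ∀ a b → col a b ≡ col b a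
    adjacent  : ∀ {a b e} → a ∈ S → b ∈ S → e ∈ S → a ~ b → a ~ e → b ≢ e → col a b ≢ col a e
    -- Consecutive edges of a 4-cycle are incident and thus covered by `adjacent`, which leaves the
    -- opposite pairs.
    opposite  : ∀ {w x y z} → w ∈ S → x ∈ S → y ∈ S → z ∈ S →
                w ~ x → x ~ y → y ~ z → z ~ w → w ≢ y → x ≢ z → col w x ≢ col y z

-- Disjointness of `T` and `Y` follows from the irreflexivity of `G`.
CompleteBipartite≥ : Graph n → ℕ → ℕ → Set
CompleteBipartite≥ G a b = ∃[ T ] ∃[ Y ]
  (a ≤ ∣ T ∣ × b ≤ ∣ Y ∣ × (∀ {t y} → t ∈ T → y ∈ Y → y ∈ N G t))

-- The `suc` says that Δ - 1 neighbours are shared, without a truncated subtraction.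
AlmostTwins : Graph n → ℕ → Set
AlmostTwins G Δ = ∃[ u ] ∃[ w ]
  (u ≢ w × ∣ N G u ∣ ≡ Δ × ∣ N G w ∣ ≡ Δ × suc ∣ N G u ∩ N G w ∣ ≡ Δ)

-- Extending a partial colouring by one vertex.

module Extension (G : Graph n) {S : Subset n} {v : Fin n} (v∈S : v ∈ S)
                 (C : PartialColouring G (S - v) K) where
  open Graph G using (_~_; N-sym; N-irrefl)
  open PartialColouring C

  T : Subset n
  T = N G v ∩ S

  R : Fin n → Subset n
  R u = N G u ∩ (S - v)

  block : Fin n → Fin n → List (Fin K)
  block u w = map (col w) (elements (R u ∩ R w))

  -- The block of u itself consists of the colours of the edges at u; the block of
  -- w ≢ u consists of the colours opposite to v u on the 4-cycles through u, v, w.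
  forbidden : Fin n → List (Fin K)
  forbidden u = concatMap (block u) (elements T)

  length-block : ∀ u w → length (block u w) ≡ ∣ R u ∩ R w ∣
  length-block u w =
    trans (length-map (col w) (elements (R u ∩ R w))) (length-elements (R u ∩ R w))

  S∖v : ∀ {x} → x ∈ S → x ≢ v → x ∈ S - v
  S∖v = x∈p∧x≢y⇒x∈p-y

  ∈-forbidden : ∀ {u w x} → x ∈ S → x ≢ v → w ∈ S → v ~ w → u ~ x → w ~ x →
                col w x ∈ᴸ forbidden u
  ∈-forbidden {u} {w} x∈ x≢v w∈ v~w u~x w~x = ∈-concatMap⁺ (block u)
    (lose (∈-elements⁺ (x∈p∩q⁺ (v~w , w∈)))
      (∈-map⁺ (col w) (∈-elements⁺ (x∈p∩q⁺
        (x∈p∩q⁺ (u~x , S∖v x∈ x≢v) , x∈p∩q⁺ (w~x , S∖v x∈ x≢v))))))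

  extend : Choice forbidden T → PartialColouring G S K
  extend choice = record
    { col = col′ ; symmetric = symmetric′ ; adjacent = adjacent′ ; opposite = opposite′ }
    where
    open Choice choice

    col′ : Fin n → Fin n → Fin K
    col′ a b with a ≟ v | b ≟ v
    ... | yes _ | _     = pick b
    ... | no  _ | yes _ = pick a
    ... | no  _ | no  _ = col a b

    symmetric′ : ∀ a b → col′ a b ≡ col′ b a
    symmetric′ a b with a ≟ v | b ≟ v
    ... | yes refl | yes refl = refl
    ... | yes _    | no  _    = refl
    ... | no  _    | yes _    = refl
    ... | no  _    | no  _    = symmetric a b

    -- Serves both kinds of conflict: with `w` equal to `u` it separates the edge `v u` from the
    -- other edges at `u`, and with `w` different from `u` it separates `v u` from the opposite edge
    -- `w x` of the 4-cycle `v u x w`.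
    clash : ∀ {u w x} → u ∈ S → v ~ u → w ∈ S → v ~ w → x ∈ S → x ≢ v → u ~ x → w ~ x →
            pick u ≢ col w x
    clash u∈ v~u w∈ v~w x∈ x≢v u~x w~x eq = permitted (x∈p∩q⁺ (v~u , u∈))
      (subst (_∈ᴸ forbidden _) (sym eq) (∈-forbidden x∈ x≢v w∈ v~w u~x w~x))

    adjacent′ : ∀ {a b e} → a ∈ S → b ∈ S → e ∈ S → a ~ b → a ~ e → b ≢ e →
                col′ a b ≢ col′ a e
    adjacent′ {a} {b} {e} a∈ b∈ e∈ ab ae b≢e with a ≟ v | b ≟ v | e ≟ v
    ... | yes refl | _        | _        = distinct (x∈p∩q⁺ (ab , b∈)) (x∈p∩q⁺ (ae , e∈)) b≢e
    ... | no  _    | yes refl | yes refl = contradiction refl b≢e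
    ... | no  _    | yes refl | no  e≢v  = clash a∈ (N-sym ab) a∈ (N-sym ab) e∈ e≢v ae ae
    ... | no  _    | no  b≢v  | yes refl = clash a∈ (N-sym ae) a∈ (N-sym ae) b∈ b≢v ab ab ∘ sym
    ... | no  a≢v  | no  b≢v  | no  e≢v  =
      adjacent (S∖v a∈ a≢v) (S∖v b∈ b≢v) (S∖v e∈ e≢v) ab ae b≢e

    opposite′ : ∀ {w x y z} → w ∈ S → x ∈ S → y ∈ S → z ∈ S →
                w ~ x → x ~ y → y ~ z → z ~ w → w ≢ y → x ≢ z → col′ w x ≢ col′ y z
    -- A 4-cycle meets `v` at most once: opposite vertices are distinct by hypothesis and
    -- consecutive ones by irreflexivity. Each of the four positions of `v` then reduces to `clash`,
    -- up to reversing edges.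
    opposite′ {w} {x} {y} {z} w∈ x∈ y∈ z∈ wx xy yz zw w≢y x≢z with w ≟ v | x ≟ v | y ≟ v | z ≟ v
    ... | yes refl | _        | yes refl | _        = contradiction refl w≢y
    ... | yes refl | _        | no  _    | yes refl = contradiction zw N-irrefl
    ... | yes refl | _        | no  y≢v  | no  _    = λ eq →
      clash x∈ wx z∈ (N-sym zw) y∈ y≢v xy (N-sym yz) (trans eq (symmetric y z))
    ... | no  _    | yes refl | yes refl | _        = contradiction xy N-irrefl
    ... | no  _    | yes refl | no  _    | yes refl = contradiction refl x≢z
    ... | no  _    | yes refl | no  _    | no  z≢v  =
      clash w∈ (N-sym wx) y∈ xy z∈ z≢v (N-sym zw) yz
    ... | no  w≢v  | no  _    | yes refl | _        = λ eq →
      clash z∈ yz x∈ (N-sym xy) w∈ w≢v zw (N-sym wx) (trans (sym eq) (symmetric w x))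
    ... | no  _    | no  x≢v  | no  _    | yes refl =
      clash y∈ (N-sym yz) w∈ zw x∈ x≢v (N-sym xy) wx ∘ sym
    ... | no  w≢v  | no  x≢v  | no  y≢v  | no  z≢v  =
      opposite (S∖v w∈ w≢v) (S∖v x∈ x≢v) (S∖v y∈ y≢v) (S∖v z∈ z≢v) wx xy yz zw w≢y x≢z

  -- The inclusion is strict because `v` is itself a neighbour of `u`. This loss of one turns Δ into
  -- Δ - 1 in all the counts below.
  R⊂N : ∀ {u} → v ~ u → R u ⊂ N G u
  R⊂N {u} v~u = p∩q⊆p (N G u) (S - v) ,
    v , N-sym v~u , λ v∈R → x∈p-y⇒x≢y S (p∩q⊆q (N G u) (S - v) v∈R) refl

  -- Counting forbidden colours, with `M` = Δ - 1 and `K` = dΔ - 2.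

  module _ {d M : ℕ} (2≤d : 2 ≤ d) (1≤M : 1 ≤ M) (2+K≡dΔ : 2 + K ≡ d * suc M)
           (degree≤ : ∀ u → degree G u ≤ suc M) where
    open ≤-Reasoning

    module _ {u : Fin n} (v~u : v ~ u) where

      ∣R∣≤M : ∣ R u ∣ ≤ M
      ∣R∣≤M = ≤-pred (<-≤-trans (p⊂q⇒∣p∣<∣q∣ (R⊂N v~u)) (degree≤ u))

      block≤M : ∀ w → length (block u w) ≤ M
      block≤M w = begin
        length (block u w) ≡⟨ length-block u w ⟩
        ∣ R u ∩ R w ∣      ≤⟨ ∣p∩q∣≤∣p∣ (R u) (R w) ⟩
        ∣ R u ∣            ≤⟨ ∣R∣≤M ⟩
        M                  ∎

      forbidden≤ : length (forbidden u) ≤ ∣ T ∣ * M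
      forbidden≤ = subst (λ t → length (forbidden u) ≤ t * M) (length-elements T)
        (length-concatMap-≤ (block u) block≤M (elements T))

      -- Taken with `a` = 1 to show that a full sum has only full blocks, and with `a` = 2 to show
      -- that in the tight case no block lacks two elements.
      forbidden-deficit : ∀ {w} a → w ∈ T → a + ∣ R u ∩ R w ∣ ≤ M →
                          a + length (forbidden u) ≤ ∣ T ∣ * M
      forbidden-deficit {w} a w∈ le = subst (λ t → a + length (forbidden u) ≤ t * M)
        (length-elements T)
        (length-concatMap-deficit (block u) block≤M (∈-elements⁺ w∈)
          (subst (λ l → a + l ≤ M) (sym (length-block u w)) le))

      forbidden-deficit₂ : ∀ {w x} → w ∈ T → x ∈ T → w ≢ x →
        ∣ R u ∩ R w ∣ < M → ∣ R u ∩ R x ∣ < M → 2 + length (forbidden u) ≤ ∣ T ∣ * M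
      forbidden-deficit₂ {w} {x} w∈ x∈ w≢x w< x< = subst (λ t → 2 + length (forbidden u) ≤ t * M)
        (length-elements T)
        (length-concatMap-deficit₂ (block u) block≤M (∈-elements⁺ w∈) (∈-elements⁺ x∈) w≢x
          (subst (_< M) (sym (length-block u w)) w<)
          (subst (_< M) (sym (length-block u x)) x<))

    T⇒~ : ∀ {u} → u ∈ T → v ~ u
    T⇒~ = p∩q⊆p (N G v) S

    few-back-neighbours : ∣ T ∣ < d → PartialColouring G S K
    -- Here `col v v` is only a default value showing that a colour exists.
    few-back-neighbours T<d = extend (choose forbidden (col v v) T λ {u} u∈ → ≤-pred (≤-pred (begin
      2 + (length (forbidden u) + ∣ T ∣) ≤⟨ +-monoʳ-≤ 2 (+-monoˡ-≤ ∣ T ∣ (forbidden≤ (T⇒~ u∈))) ⟩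
      2 + (∣ T ∣ * M + ∣ T ∣)            ≡⟨ cong (2 +_) (trans (+-comm _ ∣ T ∣) (sym (*-suc ∣ T ∣ M))) ⟩
      -- The two colours missing from dΔ are paid for by the absent back neighbour, which would
      -- contribute Δ ≥ 2.
      2 + ∣ T ∣ * suc M                  ≤⟨ +-monoˡ-≤ (∣ T ∣ * suc M) (s≤s 1≤M) ⟩
      suc ∣ T ∣ * suc M                  ≤⟨ *-monoˡ-≤ (suc M) T<d ⟩
      d * suc M                          ≡⟨ 2+K≡dΔ ⟨
      2 + K                              ∎)))

    module _ (∣T∣≡d : ∣ T ∣ ≡ d) where

      -- A full sum has no short block, so each `R u ∩ R t` has `M` elements. Since `R u` has at
      -- most `M`, it lies inside every `R t`, and adding `v` gives Δ common neighbours of all of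
      -- `T`.
      complete : ∀ {u} → u ∈ T → ∣ T ∣ * M ≤ length (forbidden u) → CompleteBipartite≥ G d (suc M)
      complete {u} u∈ full =
        T , ⁅ v ⁆ ∪ R u , ≤-reflexive (sym ∣T∣≡d) , ≤-<-trans M≤∣R∣ (p⊂q⇒∣p∣<∣q∣ R⊂) , joined
        where
        M≤∣R∩R∣ : ∀ {w} → w ∈ T → M ≤ ∣ R u ∩ R w ∣
        M≤∣R∩R∣ w∈ = ≮⇒≥ λ lt → <-irrefl refl (≤-trans (forbidden-deficit (T⇒~ u∈) 1 w∈ lt) full)

        M≤∣R∣ : M ≤ ∣ R u ∣
        M≤∣R∣ = ≤-trans (M≤∣R∩R∣ u∈) (∣p∩q∣≤∣p∣ (R u) (R u))

        R⊂ : R u ⊂ ⁅ v ⁆ ∪ R u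
        R⊂ = q⊆p∪q ⁅ v ⁆ (R u) , v , x∈p∪q⁺ (inj₁ (x∈⁅x⁆ v)) ,
             λ v∈R → x∈p-y⇒x≢y S (p∩q⊆q (N G u) (S - v) v∈R) refl

        joined : ∀ {t y} → t ∈ T → y ∈ ⁅ v ⁆ ∪ R u → y ∈ N G t
        joined {t} {y} t∈ y∈ with x∈p∪q⁻ ⁅ v ⁆ (R u) y∈
        ... | inj₁ y∈⁅v⁆ with refl ← x∈⁅y⁆⇒x≡y v y∈⁅v⁆ = N-sym (T⇒~ t∈)
        ... | inj₂ y∈R = p∩q⊆p (N G t) (S - v) (p∩q⊆q (R u) (R t)
          (p⊆q∧∣q∣≤∣p∣⇒q⊆p (p∩q⊆p (R u) (R t)) (≤-trans (∣R∣≤M (T⇒~ u∈)) (M≤∣R∩R∣ t∈)) y∈R))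

      module _ (unsaturated : ∀ {u} → u ∈ T → length (forbidden u) < ∣ T ∣ * M) where

        T*M+T≡2+K : ∣ T ∣ * M + ∣ T ∣ ≡ 2 + K
        T*M+T≡2+K = trans (+-comm _ ∣ T ∣)
          (trans (sym (*-suc ∣ T ∣ M)) (trans (cong (_* suc M) ∣T∣≡d) (sym 2+K≡dΔ)))

        -- For the vertices other than `u`, at most dM - 1 forbidden colours and the size d - 1 of
        -- `T - u` add up to at most `K`. Coloured last, `u` meets at most dM - 2 forbidden and d -
        -- 1 taken colours, one fewer than `K`.
        spare-colour : ∀ {u} → u ∈ T → 2 + length (forbidden u) ≤ ∣ T ∣ * M → PartialColouring G S K
        spare-colour {u} u∈ slack = extend (choose-last forbidden
          (choose forbidden (col v v) (T - u) λ {x} x∈ → ≤-pred (≤-pred (begin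
            2 + (length (forbidden x) + ∣ T - u ∣)     ≡⟨ cong suc (+-suc _ _) ⟨
            suc (length (forbidden x)) + suc ∣ T - u ∣ ≤⟨ +-mono-≤ (unsaturated (p─q⊆p T ⁅ u ⁆ x∈)) smaller ⟩
            ∣ T ∣ * M + ∣ T ∣                          ≡⟨ T*M+T≡2+K ⟩
            2 + K                                      ∎)))
          (≤-pred (≤-pred (begin
            3 + (length (forbidden u) + ∣ T - u ∣)     ≡⟨ cong (2 +_) (+-suc _ _) ⟨
            2 + length (forbidden u) + suc ∣ T - u ∣   ≤⟨ +-mono-≤ slack smaller ⟩
            ∣ T ∣ * M + ∣ T ∣                          ≡⟨ T*M+T≡2+K ⟩
            2 + K                                      ∎))))
          where
          smaller : ∣ T - u ∣ < ∣ T ∣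
          smaller = x∈p⇒∣p-x∣<∣p∣ u∈

        -- Together with `unsaturated` this makes every sum exactly one less than `∣ T ∣ * M`.
        module _ (tight : ∀ {u} → u ∈ T → ¬ (2 + length (forbidden u) ≤ ∣ T ∣ * M)) where

          another : ∀ u → ∃[ w ] (w ∈ T × w ≢ u)
          another u = let w , w∈ , w∉ = ∣q∣<∣p∣⇒∃x∈p∖q T ⁅ u ⁆ ∣⁅u⁆∣<∣T∣ in w , w∈ , x∉⁅y⁆⇒x≢y w∉
            where
            ∣⁅u⁆∣<∣T∣ : ∣ ⁅ u ⁆ ∣ < ∣ T ∣
            ∣⁅u⁆∣<∣T∣ = subst (λ k → suc k ≤ ∣ T ∣) (sym (∣⁅x⁆∣≡1 u)) (subst (2 ≤_) (sym ∣T∣≡d) 2≤d)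

          -- A smaller `R u` would make all blocks at `u` short; the block of `u` and that of one
          -- further vertex already give a deficit of two.
          ∣R∣≡M : ∀ {u} → u ∈ T → ∣ R u ∣ ≡ M
          ∣R∣≡M {u} u∈ = ≤-antisym (∣R∣≤M (T⇒~ u∈)) (≮⇒≥ small-absurd)
            where
            small-absurd : ¬ (∣ R u ∣ < M)
            small-absurd lt =
              let w , w∈ , w≢u = another u
              in tight u∈ (forbidden-deficit₂ (T⇒~ u∈) u∈ w∈ (w≢u ∘ sym)
                   (≤-<-trans (∣p∩q∣≤∣p∣ (R u) (R u)) lt) (≤-<-trans (∣p∩q∣≤∣p∣ (R u) (R w)) lt))

          -- If all blocks were full, the sum at `u` would attain the excluded maximum.
          differing : ∀ {u} → u ∈ T → ∃[ w ] (w ∈ T × ∣ R u ∩ R w ∣ < M)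
          differing {u} u∈ with any? (λ w → (w ∈? T) ×-dec (∣ R u ∩ R w ∣ <? M))
          ... | yes found = found
          ... | no  none  = contradiction full (<⇒≱ (unsaturated u∈))
            where
            full : ∣ T ∣ * M ≤ length (forbidden u)
            full = subst (λ t → t * M ≤ length (forbidden u)) (length-elements T)
              (length-concatMap-≥ (block u) (elements T) λ {w} w∈ →
                subst (M ≤_) (sym (length-block u w))
                  (≮⇒≥ λ lt → none (w , ∈-elements⁻ w∈ , lt)))

          module _ {u w} (u∈ : u ∈ T) (w∈ : w ∈ T) (∣R∩R∣<M : ∣ R u ∩ R w ∣ < M) where

            R⊈R : ¬ (R u ⊆ R w)
            R⊈R R⊆ = <⇒≱ ∣R∩R∣<M (≤-trans (≤-reflexive (sym (∣R∣≡M u∈)))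
              (p⊆q⇒∣p∣≤∣q∣ λ x∈ → x∈p∩q⁺ (x∈ , R⊆ x∈)))

            u≢w : u ≢ w
            u≢w refl = R⊈R ⊆-refl

            -- A third back neighbour x could differ from neither u nor w, so R u = R x = R w.
            d≡2 : d ≡ 2
            d≡2 with 2 <? d
            ... | no  2≮d = ≤-antisym (≮⇒≥ 2≮d) 2≤d
            ... | yes 2<d = contradiction (λ {y} → R⊆R) R⊈R
              where
              third : ∃[ x ] (x ∈ T × x ∉ ⁅ u ⁆ ∪ ⁅ w ⁆)
              third = ∣q∣<∣p∣⇒∃x∈p∖q T (⁅ u ⁆ ∪ ⁅ w ⁆) (begin-strict
                ∣ ⁅ u ⁆ ∪ ⁅ w ⁆ ∣     ≤⟨ ∣p∪q∣≤∣p∣+∣q∣ ⁅ u ⁆ ⁅ w ⁆ ⟩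
                ∣ ⁅ u ⁆ ∣ + ∣ ⁅ w ⁆ ∣ ≡⟨ cong₂ _+_ (∣⁅x⁆∣≡1 u) (∣⁅x⁆∣≡1 w) ⟩
                2                     <⟨ 2<d ⟩
                d                     ≡⟨ ∣T∣≡d ⟨
                ∣ T ∣                 ∎)

              x  = proj₁ third
              x∈ = proj₁ (proj₂ third)

              M≤∣Ru∩Rx∣ : M ≤ ∣ R u ∩ R x ∣
              -- Tightness allows a deficit of one at `u`, and the block of `w` has used it.
              M≤∣Ru∩Rx∣ = ≮⇒≥ λ lt → tight u∈ (forbidden-deficit₂ (T⇒~ u∈) w∈ x∈
                (λ w≡x → proj₂ (proj₂ third) (x∈p∪q⁺ (inj₂ (subst (_∈ ⁅ w ⁆) w≡x (x∈⁅x⁆ w)))))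
                ∣R∩R∣<M lt)

              M≤∣Rw∩Rx∣ : M ≤ ∣ R w ∩ R x ∣
              M≤∣Rw∩Rx∣ = ≮⇒≥ λ lt → tight w∈ (forbidden-deficit₂ (T⇒~ w∈) u∈ x∈
                (λ u≡x → proj₂ (proj₂ third) (x∈p∪q⁺ (inj₁ (subst (_∈ ⁅ u ⁆) u≡x (x∈⁅x⁆ u)))))
                (subst (λ p → ∣ p ∣ < M) (∩-comm (R u) (R w)) ∣R∩R∣<M) lt)

              R⊆R : R u ⊆ R w
              R⊆R y∈ = p∩q⊆p (R w) (R x)
                (p⊆q∧∣q∣≤∣p∣⇒q⊆p (p∩q⊆q (R w) (R x)) (≤-trans (∣R∣≤M (T⇒~ x∈)) M≤∣Rw∩Rx∣)
                (p∩q⊆q (R u) (R x)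
                (p⊆q∧∣q∣≤∣p∣⇒q⊆p (p∩q⊆p (R u) (R x)) (≤-trans (∣R∣≤M (T⇒~ u∈)) M≤∣Ru∩Rx∣) y∈)))

            degree≡ : ∀ {x} → x ∈ T → degree G x ≡ suc M
            degree≡ {x} x∈ = ≤-antisym (degree≤ x)
              (subst (_< degree G x) (∣R∣≡M x∈) (p⊂q⇒∣p∣<∣q∣ (R⊂N (T⇒~ x∈))))

            -- With more than `M` common neighbours, all of `N G u` would lie in `N G w`, and
            -- restricting to `S - v` would contradict `R⊈R`.
            common≤M : ∣ N G u ∩ N G w ∣ ≤ M
            common≤M = ≮⇒≥ λ M<∣N∩N∣ → R⊈R λ y∈ →
              let y∈N , y∈S = x∈p∩q⁻ (N G u) (S - v) y∈
              in x∈p∩q⁺ (p∩q⊆q (N G u) (N G w)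
                   (p⊆q∧∣q∣≤∣p∣⇒q⊆p (p∩q⊆p (N G u) (N G w)) (≤-trans (degree≤ u) M<∣N∩N∣) y∈N) , y∈S)

            M≤common : M ≤ ∣ N G u ∩ N G w ∣
            M≤common = ≤-trans
              -- By tightness `R u ∩ R w` has at least `M` - 1 elements; `v` is one more common
              -- neighbour.
              (≮⇒≥ λ lt → tight u∈ (forbidden-deficit (T⇒~ u∈) 2 w∈ lt))
              (p⊂q⇒∣p∣<∣q∣ {p = R u ∩ R w} {q = N G u ∩ N G w}
                ( (λ y∈ → let y∈Ru , y∈Rw = x∈p∩q⁻ (R u) (R w) y∈
                          in x∈p∩q⁺ (p∩q⊆p (N G u) (S - v) y∈Ru , p∩q⊆p (N G w) (S - v) y∈Rw))
                , v , x∈p∩q⁺ (N-sym (T⇒~ u∈) , N-sym (T⇒~ w∈))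
                , λ v∈ → proj₂ (proj₂ (proj₂ (R⊂N (T⇒~ u∈)))) (p∩q⊆p (R u) (R w) v∈)))

            almostTwins : AlmostTwins G (suc M)
            almostTwins = u , w , u≢w , degree≡ u∈ , degree≡ w∈ , cong suc (≤-antisym common≤M M≤common)

    extension : ∣ T ∣ ≤ d →
      PartialColouring G S K ⊎ CompleteBipartite≥ G d (suc M) ⊎ (d ≡ 2 × AlmostTwins G (suc M))
    extension T≤d with ∣ T ∣ ≟ℕ d
    ... | no  T≢d = inj₁ (few-back-neighbours (≤∧≢⇒< T≤d T≢d))
    ... | yes T≡d with any? (λ u → (u ∈? T) ×-dec (∣ T ∣ * M ≤? length (forbidden u)))
    ...   | yes (u , u∈ , full) = inj₂ (inj₁ (complete T≡d u∈ full))
    ...   | no  none with any? (λ u → (u ∈? T) ×-dec (2 + length (forbidden u) ≤? ∣ T ∣ * M))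
    ...     | yes (u , u∈ , slack) = inj₁ (spare-colour T≡d (λ x∈ → ≰⇒> λ full → none (_ , x∈ , full)) u∈ slack)
    ...     | no  none₂ =
      let unsaturated = λ {x} x∈ → ≰⇒> λ full → none (x , x∈ , full)
          tight       = λ {x} x∈ slack → none₂ (x , x∈ , slack)
          -- Any vertex could stand in for `v` here: the call only produces some element of `T`.
          u , u∈ , _  = another T≡d unsaturated tight v
          w , w∈ , lt = differing T≡d unsaturated tight u∈
      in inj₂ (inj₂ ( d≡2 T≡d unsaturated tight u∈ w∈ lt
                    , almostTwins T≡d unsaturated tight u∈ w∈ lt))

-- Induced subgraphs and copies of bipartite graphs.

module _ {P : Fin n → Set} (P? : ∀ x → Dec (P x)) where

  comprehension : Subset n
  comprehension = Vec.tabulate (does ∘ P?)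

  ∈-comprehension⁺ : ∀ {x} → P x → x ∈ comprehension
  ∈-comprehension⁺ {x} px =
    lookup⇒[]= x comprehension (trans (lookup∘tabulate _ x) (dec-true (P? x) px))

  ∈-comprehension⁻ : ∀ {x} → x ∈ comprehension → P x
  ∈-comprehension⁻ {x} x∈ with P? x | trans (sym (lookup∘tabulate (does ∘ P?) x)) ([]=⇒lookup x∈)
  ... | yes px | _  = px
  ... | no  _  | ()

joined? : ∀ (G : Graph n) (S : Subset n) u v → Dec (u ∈ S × v ∈ S × v ∈ N G u)
joined? G S u v = (u ∈? S) ×-dec (v ∈? S) ×-dec (v ∈? N G u)

inducedSubgraph : (G : Graph n) → Subset n → Subgraph G
inducedSubgraph G S = record
  { vertices  = S
  ; edges     = record
    { N        = λ u → comprehension (joined? G S u)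
    ; N-sym    = λ {u} {v} v∈ →
        let u∈S , v∈S , u~v = ∈-comprehension⁻ (joined? G S u) v∈
        in ∈-comprehension⁺ (joined? G S v) (v∈S , u∈S , Graph.N-sym G u~v)
    ; N-irrefl = λ {u} u∈ → Graph.N-irrefl G (proj₂ (proj₂ (∈-comprehension⁻ (joined? G S u) u∈)))
    }
  ; edges⊆    = λ {u} v∈ → proj₂ (proj₂ (∈-comprehension⁻ (joined? G S u) v∈))
  ; endpoints = λ {u} v∈ → proj₁ (∈-comprehension⁻ (joined? G S u) v∈)
  }

-- Degeneracy is applied to the subgraph induced on `S`, whose edges at `v` include all those
-- leading into `S`.
degenerate⇒few-neighbours : ∀ {d} {G : Graph n} → Degenerate d G → ∀ {S} → Nonempty S →
                            ∃[ v ] (v ∈ S × ∣ N G v ∩ S ∣ ≤ d)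
degenerate⇒few-neighbours {G = G} deg {S} S≢∅ =
  let v , v∈S , le = deg (inducedSubgraph G S) S≢∅
  in v , v∈S , ≤-trans
       (p⊆q⇒∣p∣≤∣q∣ λ x∈ → let v~x , x∈S = x∈p∩q⁻ (N G v) S x∈
                            in ∈-comprehension⁺ (joined? G S v) (v∈S , x∈S , v~x)) le

-- The subgraph keeps only the images of edges of `H`, so further edges of `G` among the image
-- vertices do no harm. Injectivity of `f` makes adjacency reflect as well.
embedding⇒copy : ∀ {m} (H : Graph m) (G : Graph n) (f : Fin m → Fin n) → Injective _≡_ _≡_ f →
                 (∀ {i j} → j ∈ N H i → f j ∈ N G (f i)) → ContainsCopy G H
embedding⇒copy {n} {m} H G f f-injective f-adjacent = image , record
  { to        = f
  ; injective = f-injective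
  ; image     = λ v → mk⇔ (∈-comprehension⁻ hit?) (∈-comprehension⁺ hit?)
  ; adjacency = λ i j → mk⇔ (λ i~j → ∈-comprehension⁺ (Linked? (f i)) (i , j , refl , refl , i~j))
                            (reflect i j)
  }
  where
  Linked : Fin n → Fin n → Set
  Linked u v = ∃[ i ] ∃[ j ] (f i ≡ u × f j ≡ v × j ∈ N H i)

  Linked? : ∀ u v → Dec (Linked u v)
  Linked? u v = any? λ i → any? λ j → (f i ≟ u) ×-dec (f j ≟ v) ×-dec (j ∈? N H i)

  hit? : ∀ v → Dec (∃[ i ] f i ≡ v)
  hit? v = any? λ i → f i ≟ v

  joined⇒~ : ∀ {u v} → Linked u v → v ∈ N G u
  joined⇒~ (i , j , refl , refl , i~j) = f-adjacent i~j

  image : Subgraph G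
  image = record
    { vertices  = comprehension hit?
    ; edges     = record
      { N        = λ u → comprehension (Linked? u)
      ; N-sym    = λ {u} {v} v∈ →
          let i , j , fi , fj , i~j = ∈-comprehension⁻ (Linked? u) v∈
          in ∈-comprehension⁺ (Linked? v) (j , i , fj , fi , Graph.N-sym H i~j)
      ; N-irrefl = λ {u} u∈ → Graph.N-irrefl G (joined⇒~ (∈-comprehension⁻ (Linked? u) u∈))
      }
    ; edges⊆    = λ {u} v∈ → joined⇒~ (∈-comprehension⁻ (Linked? u) v∈)
    ; endpoints = λ {u} v∈ → let i , _ , fi , _ = ∈-comprehension⁻ (Linked? u) v∈
                             in ∈-comprehension⁺ hit? (i , fi)
    }

  reflect : ∀ i j → f j ∈ comprehension (Linked? (f i)) → j ∈ N H i
  reflect i j fj∈ with i′ , j′ , fi , fj , i~j ← ∈-comprehension⁻ (Linked? (f i)) fj∈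
    with refl ← f-injective fi | refl ← f-injective fj = i~j

-- The vertices `u` and `w` take the indices below 2, and the enumerated common neighbours take the
-- rest; irreflexivity of `G` keeps the two sides apart.
common-neighbours⇒K₂ₘ : ∀ (G : Graph n) {u w} → u ≢ w →
                        ContainsCopy G (completeBipartite 2 ∣ N G u ∩ N G w ∣)
common-neighbours⇒K₂ₘ {n} G {u} {w} u≢w = embedding⇒copy (completeBipartite 2 m) G f f-injective
  λ {i} {j} j∈ → f-adjacent i j (trans
    (sym (lookup∘tabulate (λ k → does (toℕ i <? 2) xor does (toℕ k <? 2)) j)) ([]=⇒lookup j∈))
  where
  open Graph G using (N-sym; N-irrefl)

  m = ∣ N G u ∩ N G w ∣

  f : Fin (2 + m) → Fin n
  f zero          = u
  f (suc zero)    = w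
  f (suc (suc i)) = nth (N G u ∩ N G w) i

  u~nth : ∀ i → nth (N G u ∩ N G w) i ∈ N G u
  u~nth i = p∩q⊆p (N G u) (N G w) (nth-∈ (N G u ∩ N G w) i)

  w~nth : ∀ i → nth (N G u ∩ N G w) i ∈ N G w
  w~nth i = p∩q⊆q (N G u) (N G w) (nth-∈ (N G u ∩ N G w) i)

  u≢nth : ∀ i → u ≢ nth (N G u ∩ N G w) i
  u≢nth i eq = N-irrefl (subst (_∈ N G u) (sym eq) (u~nth i))

  w≢nth : ∀ i → w ≢ nth (N G u ∩ N G w) i
  w≢nth i eq = N-irrefl (subst (_∈ N G w) (sym eq) (w~nth i))

  f-injective : Injective _≡_ _≡_ f
  f-injective {zero}        {zero}        _  = refl
  f-injective {zero}        {suc zero}    eq = contradiction eq u≢w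
  f-injective {zero}        {suc (suc j)} eq = contradiction eq (u≢nth j)
  f-injective {suc zero}    {zero}        eq = contradiction (sym eq) u≢w
  f-injective {suc zero}    {suc zero}    _  = refl
  f-injective {suc zero}    {suc (suc j)} eq = contradiction eq (w≢nth j)
  f-injective {suc (suc i)} {zero}        eq = contradiction (sym eq) (u≢nth i)
  f-injective {suc (suc i)} {suc zero}    eq = contradiction (sym eq) (w≢nth i)
  f-injective {suc (suc i)} {suc (suc j)} eq =
    cong (λ k → suc (suc k)) (nth-injective (N G u ∩ N G w) eq)

  f-adjacent : ∀ i j → does (toℕ i <? 2) xor does (toℕ j <? 2) ≡ inside → f j ∈ N G (f i)
  f-adjacent zero          (suc (suc j)) _ = u~nth j
  f-adjacent (suc zero)    (suc (suc j)) _ = w~nth j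
  f-adjacent (suc (suc i)) zero          _ = N-sym (u~nth i)
  f-adjacent (suc (suc i)) (suc zero)    _ = N-sym (w~nth i)
  f-adjacent zero          zero          ()
  f-adjacent zero          (suc zero)    ()
  f-adjacent (suc zero)    zero          ()
  f-adjacent (suc zero)    (suc zero)    ()
  f-adjacent (suc (suc i)) (suc (suc j)) ()

-- Degree bound, lower bound on colours, and full colourings.

degree≤maxDegree : ∀ (G : Graph n) v → degree G v ≤ maxDegree G
degree≤maxDegree G = ≤foldr (degree G)
  where
  ≤foldr : ∀ {m} (f : Fin m → ℕ) i → f i ≤ Functional.foldr _⊔_ 0 f
  ≤foldr f zero    = m≤m⊔n _ _
  ≤foldr f (suc i) = ≤-trans (≤foldr (f ∘ suc) i) (m≤n⊔m (f zero) _)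

-- Any two edges of a complete bipartite graph are incident or opposite on a 4-cycle.
completeBipartite-needs : ∀ {G : Graph n} {a b} → CompleteBipartite≥ G a b → BColouring G K → a * b ≤ K
completeBipartite-needs {n} {K} {G} {a} {b} (T , Y , a≤ , b≤ , joined) C =
  ≤-trans (*-mono-≤ a≤ b≤) (injective⇒≤ f-injective)
  where
  open BColouring C
  open Graph G using (_~_; N-sym; N-irrefl)

  edgeColour : Fin ∣ T ∣ × Fin ∣ Y ∣ → Fin K
  edgeColour (i , j) = colour (nth T i) (nth Y j) (joined (nth-∈ T i) (nth-∈ Y j))

  T≢Y : ∀ {t y} → t ∈ T → y ∈ Y → t ≢ y
  T≢Y t∈ y∈ refl = N-irrefl (joined t∈ y∈)

  distinct : ∀ i j i′ j′ → edgeColour (i , j) ≡ edgeColour (i′ , j′) → (i , j) ≡ (i′ , j′)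
  distinct i j i′ j′ eq with i ≟ i′ | j ≟ j′
  ... | yes refl | yes refl = refl
  ... | yes refl | no  j≢   = contradiction eq (proper _ _ (j≢ ∘ nth-injective Y))
  ... | no  i≢   | yes refl = contradiction
    (trans (sym (undirected _ _)) (trans eq (undirected _ _)))
    (proper (N-sym (joined (nth-∈ T i) (nth-∈ Y j))) (N-sym (joined (nth-∈ T i′) (nth-∈ Y j)))
      (i≢ ∘ nth-injective T))
  ... | no  i≢   | no  j≢ with
    rainbow-C₄ {nth T i} {nth Y j} {nth T i′} {nth Y j′}
      ((T≢Y t y ∷ i≢ ∘ nth-injective T ∷ T≢Y t y′ ∷ []) ∷
       ((T≢Y t′ y ∘ sym) ∷ j≢ ∘ nth-injective Y ∷ []) ∷ (T≢Y t′ y′ ∷ []) ∷ [] ∷ [])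
      (joined t y) (N-sym (joined t′ y)) (joined t′ y′) (N-sym (joined t y′))
    where
    t  = nth-∈ T i
    t′ = nth-∈ T i′
    y  = nth-∈ Y j
    y′ = nth-∈ Y j′
  ...   | (_ ∷ c≢ ∷ _ ∷ []) ∷ _ = contradiction eq c≢

  f : Fin (∣ T ∣ * ∣ Y ∣) → Fin K
  f = edgeColour ∘ remQuot ∣ Y ∣

  f-injective : Injective _≡_ _≡_ f
  f-injective {k} {l} eq = trans (sym (combine-remQuot {∣ T ∣} ∣ Y ∣ k))
    (trans (cong (uncurry combine) (distinct _ _ _ _ eq)) (combine-remQuot {∣ T ∣} ∣ Y ∣ l))

partial⇒BColouring : ∀ {G : Graph n} → PartialColouring G ⊤ K → BColouring G K
partial⇒BColouring {G = G} C = record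
  { colour     = λ u v _ → col u v
  ; undirected = λ {u} {v} _ _ → symmetric u v
  ; proper     = λ e f v≢w → adjacent ∈⊤ ∈⊤ ∈⊤ e f v≢w
  ; rainbow-C₄ = rainbow
  }
  where
  open PartialColouring C
  open Graph G using (_~_; N-sym)

  meet : ∀ {a b e} → a ~ b → b ~ e → a ≢ e → col a b ≢ col b e
  meet {a} {b} ab be a≢e eq =
    adjacent ∈⊤ ∈⊤ ∈⊤ (N-sym ab) be a≢e (trans (symmetric b a) eq)

  rainbow : ∀ {w x y z} → Unique (w ∷ x ∷ y ∷ z ∷ []) → w ~ x → x ~ y → y ~ z → z ~ w →
            Unique (col w x ∷ col x y ∷ col y z ∷ col z w ∷ [])
  -- Of the six pairs of edges, four are consecutive and share a vertex, and two are opposite.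
  rainbow ((_ ∷ w≢y ∷ _ ∷ []) ∷ (_ ∷ x≢z ∷ []) ∷ _) wx xy yz zw =
    (meet wx xy w≢y ∷ opposite ∈⊤ ∈⊤ ∈⊤ ∈⊤ wx xy yz zw w≢y x≢z ∷ (meet zw wx (x≢z ∘ sym) ∘ sym) ∷ []) ∷
    (meet xy yz x≢z ∷ opposite ∈⊤ ∈⊤ ∈⊤ ∈⊤ xy yz zw wx x≢z (w≢y ∘ sym) ∷ []) ∷
    (meet yz zw (w≢y ∘ sym) ∷ []) ∷ [] ∷ []

-- Induction over vertex sets and the conclusion.

colour-or-obstruction : ∀ {d M} → 2 ≤ d → 1 ≤ M → Fin K → 2 + K ≡ d * suc M →
  (G : Graph n) → Degenerate d G → (∀ u → degree G u ≤ suc M) →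
  BColouring G K ⊎ CompleteBipartite≥ G d (suc M) ⊎ (d ≡ 2 × AlmostTwins G (suc M))
colour-or-obstruction {K} {n} {d} {M} 2≤d 1≤M c₀ 2+K≡dΔ G deg degree≤ =
  map₁ partial⇒BColouring (go ⊤ (⊂-wellFounded ⊤))
  where
  go : ∀ S → Acc _⊂_ S →
    PartialColouring G S K ⊎ CompleteBipartite≥ G d (suc M) ⊎ (d ≡ 2 × AlmostTwins G (suc M))
  go S (acc rec) with nonempty? S
  ... | no  S≡∅ = inj₁ record
    { col       = λ _ _ → c₀
    ; symmetric = λ _ _ → refl
    ; adjacent  = λ a∈ → ⊥-elim (S≡∅ (_ , a∈))
    ; opposite  = λ w∈ → ⊥-elim (S≡∅ (_ , w∈))
    }
  ... | yes S≢∅ with v , v∈ , few ← degenerate⇒few-neighbours deg S≢∅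
    with go (S - v) (rec (x∈p⇒p-x⊂p v∈))
  ...   | inj₁ C   = Extension.extension G v∈ C 2≤d 1≤M 2+K≡dΔ degree≤ few
  -- An obstruction concerns all of `G` and not the current vertex set, so it passes up unchanged.
  ...   | inj₂ obs = inj₂ obs

-- Two outcomes are impossible: a colouring with dΔ - 2 colours contradicts minimality, and a
-- complete bipartite subgraph with sides of at least d and Δ vertices needs dΔ colours although dΔ
-- - 1 suffice.
extremal⇒almostTwins : ∀ {d M} → 2 ≤ d → d ≤ suc M → (G : Graph n) → Degenerate d G →
  maxDegree G ≤ suc M → qB G ≔ (d * suc M ∸ 1) → d ≡ 2 × AlmostTwins G (suc M)
extremal⇒almostTwins {d = d} {M} 2≤d d≤Δ G deg maxDeg (C , least) =
  [ (λ C′ → contradiction (least _ C′) (<⇒≱ K<dΔ∸1))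
  , [ (λ complete → contradiction (completeBipartite-needs complete C) (<⇒≱ dΔ∸1<dΔ)) , id ]′
  ]′ (colour-or-obstruction 2≤d 1≤M (fromℕ< 0<K) 2+K≡dΔ G deg
       (λ u → ≤-trans (degree≤maxDegree G u) maxDeg))
  where
  1≤M : 1 ≤ M
  1≤M = ≤-pred (≤-trans 2≤d d≤Δ)

  -- Makes both truncated subtractions exact and provides a colour, as dΔ - 2 is positive.
  4≤dΔ : 4 ≤ d * suc M
  4≤dΔ = *-mono-≤ 2≤d (s≤s 1≤M)

  2+K≡dΔ : 2 + (d * suc M ∸ 2) ≡ d * suc M
  2+K≡dΔ = m+[n∸m]≡n (≤-trans (s≤s (s≤s z≤n)) 4≤dΔ)

  K<dΔ∸1 : d * suc M ∸ 2 < d * suc M ∸ 1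
  K<dΔ∸1 = ∸-monoʳ-< ≤-refl (≤-trans (s≤s (s≤s z≤n)) 4≤dΔ)

  dΔ∸1<dΔ : d * suc M ∸ 1 < d * suc M
  dΔ∸1<dΔ = ∸-monoʳ-< {d * suc M} {1} {0} ≤-refl (≤-trans (s≤s z≤n) 4≤dΔ)

  0<K : 0 < d * suc M ∸ 2
  0<K = ≤-trans (s≤s z≤n) (∸-monoˡ-≤ 2 4≤dΔ)

corollary2p5 : ∀ (d Δ : ℕ) → 2 ≤ d → d ≤ Δ →
    ∀ {n : ℕ} (G : Graph n) → Degenerate d G → maxDegree G ≤ Δ →
    qB G ≔ (d * Δ ∸ 1) →
    (∃[ X ] ∃[ Y ] ∃[ u* ]
    ( u* ∉ X
    × ∣ X ∣ ≡ d ∸ 1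
    × ∣ Y ∣ ≡ Δ
    × (∀ x → x ∈ X → N G x ≡ Y)
    × ∣ Y ─ N G u* ∣ ≡ 1
    × ∣ N G u* ─ Y ∣ ≤ 1
    × (∀ x x′ → x ∈ X → x′ ∈ X → x ≢ x′ → FalseTwins G x x′)
    × (∀ x → x ∈ X → degree G x ≡ Δ)))
    × ContainsCopy G (completeBipartite d (Δ ∸ 1))
corollary2p5 d zero    2≤d d≤Δ = contradiction (≤-trans 2≤d d≤Δ) λ ()
corollary2p5 d (suc M) 2≤d d≤Δ {n} G deg maxDeg q with extremal⇒almostTwins 2≤d d≤Δ G deg maxDeg q
... | refl , u , w , u≢w , deg-u , deg-w , common =
  -- As d is now 2, `X` needs a single vertex: take `u`, with `Y` its neighbourhood and `w` as `u*`.
  -- The false-twin clause holds since a singleton has no two distinct elements. Both set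
  -- differences have exactly one element.
  ( ⁅ u ⁆ , N G u , w , u≢w ∘ sym ∘ x∈⁅y⁆⇒x≡y u , ∣⁅x⁆∣≡1 u , deg-u
  , (λ x x∈ → cong (N G) (x∈⁅y⁆⇒x≡y u x∈))
  , one-missing (N G u) (N G w) deg-u common
  , ≤-reflexive (one-missing (N G w) (N G u) deg-w
      (trans (cong (suc ∘ ∣_∣) (∩-comm (N G w) (N G u))) common))
  , (λ x x′ x∈ x′∈ x≢x′ → contradiction (trans (x∈⁅y⁆⇒x≡y u x∈) (sym (x∈⁅y⁆⇒x≡y u x′∈))) x≢x′)
  , (λ x x∈ → trans (cong (degree G) (x∈⁅y⁆⇒x≡y u x∈)) deg-u) )
  , subst (ContainsCopy G ∘ completeBipartite 2) (cong pred common) (common-neighbours⇒K₂ₘ G u≢w)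
  where
  one-missing : ∀ (p q : Subset n) → ∣ p ∣ ≡ suc M → suc ∣ p ∩ q ∣ ≡ suc M → ∣ p ─ q ∣ ≡ 1
  one-missing p q ∣p∣≡ ∣p∩q∣≡ = +-cancelˡ-≡ ∣ p ∩ q ∣ ∣ p ─ q ∣ 1
    (trans (sym (∣p∣≡∣p∩q∣+∣p─q∣ p q)) (trans ∣p∣≡ (trans (sym ∣p∩q∣≡) (+-comm 1 ∣ p ∩ q ∣))))
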